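{- Let $X$ be a type and $\sim:X\to X\to\mathbb P$ a decidable equivalence relation. Suppose we are given a list $l_r$ over $X$ such that every $x:X$ has some $y\in l_r$ with $x\sim y$. Then one can compute $n:\mathbb N$ and functions $c:X\to\mathrm{Fin}\,n$ and $r:\mathrm{Fin}\,n\to X$ such that: <ul> <li>$c(r\,p)=p$ for all $p:\mathrm{Fin}\,n$;</li> <li>$x\sim y\leftrightarrow c\,x=c\,y$ for all $x,y:X$.</li> </ul>
   Context: This is stated in constructive type theory, where "one can compute" means the data is constructed in $\mathsf{Type}$ rather than merely proved to exist. The list $l_r$ is given as data. $\mathrm{Fin}\,n$ is the finite type $\{0,\dots,n-1\}$. A relation is decidable if a Boolean-valued function characterises it. -}

module Defs where

open import Level using (Level; _⊔_)
open import Data.Irrelevant using (Irrelevant)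
open import Data.Product using (∃)

private
  variable
    a p : Level

-- Existence in a universe of propositions: the witness is known to exist
-- but is not available as data.  The ordinary ∃ would hand the witness over.
∃ₚ : {A : Set a} → (A → Set p) → Set (a ⊔ p)
∃ₚ P = Irrelevant (∃ P)

{-# OPTIONS --safe #-}
-- Deduplicating lᵣ up to ∼ leaves exactly one representative of each class:
-- c x is the position of the representative of x, and r looks up a position.
module Submission where

open import Level using (Level)
open import Data.Nat using (ℕ)
open import Data.Fin using (Fin; zero; suc)
open import Data.Irrelevant as Irrelevant using ([_])
open import Data.List using (List; _∷_; length; lookup; deduplicate)
open import Data.List.Membership.Propositional using (_∈_; lose)
import Data.List.Membership.Setoid as SetoidMembership
open import Data.List.Membership.Setoid.Properties using (∈-deduplicate⁺; index-injective)
open import Data.List.Membership.Propositional.Properties using (∈-lookup)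
import Data.List.Relation.Unary.All as All
open import Data.List.Relation.Unary.AllPairs using (_∷_)
open import Data.List.Relation.Unary.Any using (any?; index)
open import Data.List.Relation.Unary.Any.Properties using (lookup-index)
import Data.List.Relation.Unary.Unique.Setoid as SetoidUnique
open import Data.List.Relation.Unary.Unique.DecSetoid.Properties using (deduplicate-!)
open import Data.Product using (Σ-syntax; _×_; _,_)
open import Function.Bundles using (_⇔_; mk⇔)
open import Relation.Binary.Bundles using (Setoid; DecSetoid)
open import Relation.Binary.Core using (Rel)
open import Relation.Binary.Definitions using (Decidable)
open import Relation.Binary.Structures using (IsEquivalence)
open import Relation.Binary.PropositionalEquality using (_≡_; refl; cong)
open import Relation.Nullary using (contradiction)
open import Relation.Nullary.Decidable using (recompute)
open import Defs

-- A list that meets every class and has no two equivalent entries meets each class at exactly one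
-- position. So any position whose entry is equivalent to `x` must be `c x`; this uniqueness
-- (`class-unique`, from `lookup-injective`) gives `c (r p) ≡ p` and invariance of `c` under `∼`.

module _ {a ℓ} (S : Setoid a ℓ) where
  open Setoid S using (_≈_; sym)
  open SetoidUnique S using (Unique)

  lookup-injective : ∀ {xs} → Unique xs → ∀ i j → lookup xs i ≈ lookup xs j → i ≡ j
  lookup-injective (_ ∷ _)   zero    zero    _  = refl
  lookup-injective (x≉ ∷ _)  zero    (suc j) eq =
    contradiction eq (All.lookup x≉ (∈-lookup j))
  -- `Unique` only separates an entry from later ones, so this order needs symmetry.
  lookup-injective (x≉ ∷ _)  (suc i) zero    eq =
    contradiction (sym eq) (All.lookup x≉ (∈-lookup i))
  lookup-injective (_ ∷ xs!) (suc i) (suc j) eq =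
    cong suc (lookup-injective xs! i j eq)

theorem9 : ∀ {a ℓ : Level} (X : Set a) (_∼_ : Rel X ℓ) →
    IsEquivalence _∼_ → Decidable _∼_ →
    (lᵣ : List X) →
    (∀ (x : X) → ∃ₚ (λ y → y ∈ lᵣ × x ∼ y)) →
    Σ[ n ∈ ℕ ] Σ[ c ∈ (X → Fin n) ] Σ[ r ∈ (Fin n → X) ]
    ((∀ (p : Fin n) → c (r p) ≡ p) ×
    (∀ (x y : X) → (x ∼ y) ⇔ (c x ≡ c y)))
theorem9 {a} {ℓ} X _∼_ isEquiv _∼?_ lᵣ covered =
  length reps , class , lookup reps ,
  (λ p → class-unique (lookup reps p) p ∼.refl) ,
  λ x y → mk⇔
    (λ x∼y → class-unique x (class y) (∼.trans x∼y (lookup-index (rep∈ y))))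
    -- Equal positions make `x` and `y` equivalent to one common entry.
    (index-injective S (rep∈ x) (rep∈ y))
  where
  module ∼ = IsEquivalence isEquiv

  DS : DecSetoid a ℓ
  DS = record
    { isDecEquivalence = record { isEquivalence = isEquiv ; _≟_ = _∼?_ } }

  S : Setoid a ℓ
  S = DecSetoid.setoid DS

  open SetoidMembership S using () renaming (_∈_ to _∈∼_)

  reps : List X
  reps = deduplicate _∼?_ lᵣ

  -- Mere existence suffices: membership up to ∼ in a list is decidable, so an
  -- irrelevant proof of it can be recomputed by search.
  covered∈ : ∀ x → x ∈∼ lᵣ
  covered∈ x with [ x∈∼lᵣ ] ← Irrelevant.map (λ (_ , y∈lᵣ , x∼y) → lose y∈lᵣ x∼y) (covered x) =
    recompute (any? (x ∼?_) lᵣ) x∈∼lᵣ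

  rep∈ : ∀ x → x ∈∼ reps
  -- If `w` is matched by an entry `y` dropped in favour of `z`, then `z` also matches `w`.
  rep∈ x = ∈-deduplicate⁺ S _∼?_ (λ z∼y w∼y → ∼.trans w∼y (∼.sym z∼y)) (covered∈ x)

  class : X → Fin (length reps)
  class x = index (rep∈ x)

  -- The entries at `class x` and at `p` are both equivalent to `x`, and distinct positions of
  -- `reps` hold inequivalent entries.
  class-unique : ∀ x p → x ∼ lookup reps p → class x ≡ p
  class-unique x p x∼p = lookup-injective S (deduplicate-! DS lᵣ) (class x) p
    (∼.trans (∼.sym (lookup-index (rep∈ x))) x∼p)
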